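{- Let $\Gamma$ be a finite simple graph with more than one vertex which has exactly one universal vertex. Then the generalised CAP bound for $\Gamma$ is strictly smaller than the Haemers bound for $\Gamma$.
   Context: A universal vertex is a vertex adjacent to every other vertex. For a finite simple graph $G$ on $v$ vertices, and a positive integer $s$, let $$\mathrm{CA}_G(x,s,k,\lambda):=x(x+1)(v-s)-2xs(k-s+1)+s(s-1)(\lambda-s+2).$$ The edge-degree of an edge is the number of common neighbours of its two endpoints. Let $G$ have at least one edge, let $\delta,\Delta$ be its minimum and maximum vertex degrees, and $\lambda_{\min},\lambda_{\max}$ the minimum and maximum edge-degrees of its edges. For every clique of $G$ with at least two vertices, the average vertex degree in $G$ over the clique lies in $[\delta,\Delta]$ and the average edge-degree in $G$ over pairs of vertices in the clique lies in $[\lambda_{\min},\lambda_{\max}]$. If for every real pair $(k,\lambda)\in[\delta,\Delta]\times[\lambda_{\min},\lambda_{\max}]$ there is an integer $x$ with $\mathrm{CA}_G(x,s,k,\lambda)<0$, then $G$ has no $s$-clique. The generalised CAP bound for $G$ is the least value of $s-1$ over all positive integers $s$ with this property. The Haemers bound for a non-complete graph $G$ on $v$ vertices is the real number $$\frac{ -v\gamma_1'\gamma_v'}{(v-\Delta-1)^2-\gamma_1'\gamma_v'},$$ where $\gamma_1'$ and $\gamma_v'$ are the maximum and minimum eigenvalues of the adjacency matrix of the complement $\overline{G}$, and $\Delta$ is the maximum degree of $G$. -}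

module Defs where

open import Algebra.Bundles using (CommutativeRing)
import Algebra.Definitions.RawMonoid as RawMonoidDefinitions
open import Data.Bool.Base using (if_then_else_)
open import Data.Fin.Base using (Fin)
open import Data.Fin.Properties using () renaming (_≟_ to _≟ᶠ_)
open import Data.Fin.Subset using (Subset; _∩_; ∣_∣)
open import Data.Integer.Base using (ℤ; +_; -[1+_])
open import Data.List.Base using (List; map; filter; allFin; cartesianProduct)
open import Data.List.Extrema.Nat using (min; max)
open import Data.Nat.Base as ℕ using (ℕ; suc)
open import Data.Product using (Σ-syntax; ∃; ∃-syntax; ∃!; _×_; _,_; proj₁; proj₂; uncurry)
open import Data.Vec.Base using (tabulate)
open import Data.Vec.Functional using (Vector)
open import Level using (0ℓ) renaming (suc to lsuc)
open import Relation.Binary.Core using (Rel)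
open import Relation.Binary.Definitions using (Decidable; Symmetric; Irreflexive)
open import Relation.Binary.PropositionalEquality.Core using (_≡_; _≢_; ≢-sym)
open import Relation.Binary.Structures using (IsStrictTotalOrder)
import Relation.Binary.Construct.StrictToNonStrict as StrictToNonStrict
open import Relation.Nullary.Decidable.Core using (does; ¬?; _×-dec_)
open import Relation.Nullary.Negation.Core using (¬_)
open import Relation.Unary using (Pred; Satisfiable)

-- The real numbers are axiomatised as a Dedekind-complete ordered field, a
-- structure that is classically unique up to unique isomorphism.
record CompleteOrderedField : Set (lsuc 0ℓ) where
  infix 4 _<_
  field
    commutativeRing : CommutativeRing 0ℓ 0ℓ

  open CommutativeRing commutativeRing public

  field
    _<_                  : Rel Carrier 0ℓ
    <-isStrictTotalOrder : IsStrictTotalOrder _≈_ _<_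
    +-monoˡ-<            : ∀ z {x y} → x < y → x + z < y + z
    *-pos                : ∀ {x y} → 0# < x → 0# < y → 0# < x * y
    0≉1                  : 0# ≉ 1#
    inverse              : ∀ x → x ≉ 0# → ∃[ y ] x * y ≈ 1#

  open StrictToNonStrict _≈_ _<_ public using (_≤_)

  UpperBound : Pred Carrier 0ℓ → Pred Carrier 0ℓ
  UpperBound P b = ∀ x → P x → x ≤ b

  field
    supremum : (P : Pred Carrier 0ℓ) → Satisfiable P → ∃ (UpperBound P) →
               ∃[ b ] UpperBound P b × (∀ b′ → UpperBound P b′ → b ≤ b′)

  open RawMonoidDefinitions +-rawMonoid public
    using (sum) renaming (_×_ to _×ᴺ_)

  fromℕ : ℕ → Carrier
  fromℕ n = n ×ᴺ 1#

  fromℤ : ℤ → Carrier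
  fromℤ (+ n)    = fromℕ n
  fromℤ -[1+ n ] = - fromℕ (suc n)

  divide : (x y : Carrier) → y ≉ 0# → Carrier
  divide x y y≉0 = x * proj₁ (inverse y y≉0)

record Graph (v : ℕ) : Set₁ where
  infix 4 _~_ _~?_
  field
    _~_      : Rel (Fin v) 0ℓ
    _~?_     : Decidable _~_
    ~-sym    : Symmetric _~_
    ~-irrefl : Irreflexive _≡_ _~_

module _ {v : ℕ} (G : Graph v) where
  open Graph G

  Universal : Pred (Fin v) 0ℓ
  Universal u = ∀ w → w ≢ u → u ~ w

  HasExactlyOneUniversalVertex : Set
  HasExactlyOneUniversalVertex = ∃! _≡_ Universal

  complement : Graph v
  complement = record
    { _~_      = λ i j → i ≢ j × ¬ (i ~ j)
    ; _~?_     = λ i j → ¬? (i ≟ᶠ j) ×-dec ¬? (i ~? j)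
    ; ~-sym    = λ (i≢j , i≁j) → ≢-sym i≢j , λ j~i → i≁j (~-sym j~i)
    ; ~-irrefl = λ i≡j (i≢j , _) → i≢j i≡j
    }

  neighbours : Fin v → Subset v
  neighbours i = tabulate (λ j → does (i ~? j))

  degree : Fin v → ℕ
  degree i = ∣ neighbours i ∣

  edgeDegree : Fin v → Fin v → ℕ
  edgeDegree i j = ∣ neighbours i ∩ neighbours j ∣

  degrees : List ℕ
  degrees = map degree (allFin v)

  -- Every edge occurs in both orientations, which does not affect the extrema.
  edgeDegrees : List ℕ
  edgeDegrees = map (uncurry edgeDegree)
    (filter (uncurry _~?_) (cartesianProduct (allFin v) (allFin v)))

  -- The first argument of min and max is the value at the empty list. All
  -- degrees and edge-degrees lie between 0 and v, so it is irrelevant as soon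
  -- as the graph has a vertex, respectively an edge.
  minDegree maxDegree minEdgeDegree maxEdgeDegree : ℕ
  minDegree     = min v degrees
  maxDegree     = max 0 degrees
  minEdgeDegree = min v edgeDegrees
  maxEdgeDegree = max 0 edgeDegrees

module _ (R : CompleteOrderedField) where
  open CompleteOrderedField R

  _∈[_,_] : Carrier → ℕ → ℕ → Set
  x ∈[ a , b ] = fromℕ a ≤ x × x ≤ fromℕ b

  CA : {v : ℕ} → Graph v → ℤ → ℕ → Carrier → Carrier → Carrier
  CA {v} G x′ s′ k ℓ =
      x * (x + 1#) * (fromℕ v - s)
    - fromℕ 2 * x * s * (k - s + 1#)
    + s * (s - 1#) * (ℓ - s + fromℕ 2)
    where
      x = fromℤ x′
      s = fromℕ s′

  CAPExcludes : {v : ℕ} → Graph v → ℕ → Set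
  CAPExcludes G s = ∀ k ℓ →
    k ∈[ minDegree G , maxDegree G ] →
    ℓ ∈[ minEdgeDegree G , maxEdgeDegree G ] →
    ∃[ x ] CA G x s k ℓ < 0#

  -- Positive clique sizes s are written suc b, so that s - 1 is b.
  IsGeneralisedCAPBound : {v : ℕ} → Graph v → ℕ → Set
  IsGeneralisedCAPBound G b =
    CAPExcludes G (suc b) × (∀ b′ → CAPExcludes G (suc b′) → b ℕ.≤ b′)

  Matrix : ℕ → Set
  Matrix n = Fin n → Fin n → Carrier

  IsEigenvalue : {n : ℕ} → Matrix n → Carrier → Set
  IsEigenvalue {n} A γ = Σ[ x ∈ Vector Carrier n ]
    (¬ (∀ i → x i ≈ 0#)) × (∀ i → sum (λ j → A i j * x j) ≈ γ * x i)

  IsMaxEigenvalue IsMinEigenvalue : {n : ℕ} → Matrix n → Carrier → Set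
  IsMaxEigenvalue A γ = IsEigenvalue A γ × (∀ γ′ → IsEigenvalue A γ′ → γ′ ≤ γ)
  IsMinEigenvalue A γ = IsEigenvalue A γ × (∀ γ′ → IsEigenvalue A γ′ → γ ≤ γ′)

  adjacencyMatrix : {v : ℕ} → Graph v → Matrix v
  adjacencyMatrix G i j = if does (i ~? j) then 1# else 0#
    where open Graph G

  -- In the next two definitions γ₁ and γᵥ stand for the maximum and minimum
  -- eigenvalues of the adjacency matrix of the complement of G.
  haemersDenominator : {v : ℕ} → Graph v → (γ₁ γᵥ : Carrier) → Carrier
  haemersDenominator {v} G γ₁ γᵥ = d * d - γ₁ * γᵥ
    where d = fromℕ v - fromℕ (maxDegree G) - 1#

  haemersBound : {v : ℕ} (G : Graph v) (γ₁ γᵥ : Carrier) →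
                 haemersDenominator G γ₁ γᵥ ≉ 0# → Carrier
  haemersBound {v} G γ₁ γᵥ =
    divide (- (fromℕ v * γ₁ * γᵥ)) (haemersDenominator G γ₁ γᵥ)

module Submission where

open import Defs
import Algebra.Properties.Ring as RingProperties
import Algebra.Properties.Semiring.Mult as SemiringMult
import Algebra.Properties.Semiring.Sum as SemiringSum
import Algebra.Solver.Ring as RingSolver
open import Algebra.Solver.Ring.AlmostCommutativeRing
  using (fromCommutativeRing; _-Raw-AlmostCommutative⟶_)
open import Data.Bool.Base using (if_then_else_)
open import Data.Fin.Base using (Fin; zero; suc)
import Data.Fin.Properties as Fin
open import Data.Fin.Subset using (_∈_; _⊆_; ∁; ⁅_⁆; ∣_∣)
open import Data.Fin.Subset.Properties
open import Data.Integer.Base as ℤ using (ℤ; +_; -[1+_])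
import Data.Integer.Properties as ℤ
open import Data.List.Base using (allFin; cartesianProduct)
open import Data.List.Extrema.Nat using (max; max≈v⁺; max<v⁺)
import Data.List.Membership.Propositional as List
open import Data.List.Membership.Propositional.Properties using (∈-map⁺; ∈-allFin)
open import Data.List.Relation.Unary.All as All using (All)
import Data.List.Relation.Unary.All.Properties as All
open import Data.Maybe.Base using (map)
open import Data.Nat.Base as ℕ using (ℕ; suc; z≤n; s≤s)
import Data.Nat.Properties as ℕ
open import Data.Product.Base using (Σ-syntax; ∃-syntax; _×_; _,_; proj₁; proj₂; uncurry)
open import Data.Sum.Base as Sum using (_⊎_; inj₁; inj₂; [_,_])
open import Data.Vec.Functional using (Vector; _∷_; tail; replicate)
open import Data.Vec.Properties using (lookup∘tabulate; lookup⇒[]=; []=⇒lookup)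
open import Function.Base using (_∘_)
open import Function.Bundles using (mk⇔)
import Relation.Binary.Construct.StrictToNonStrict as StrictToNonStrict
open import Relation.Binary.Consequences using (dec⇒weaklyDec)
open import Relation.Binary.Definitions using (tri<; tri≈; tri>)
open import Relation.Binary.PropositionalEquality.Core as ≡ using (_≡_; _≢_; ≢-sym)
import Relation.Binary.Reasoning.Setoid as SetoidReasoning
open import Relation.Binary.Structures using (IsStrictTotalOrder)
open import Relation.Nullary.Decidable
  using (yes; no; does; decidable-stable; does-⇔; dec-true; dec-false; ¬?; _→-dec_)
open import Relation.Nullary.Negation.Core using (¬_; contradiction)

-- One universal vertex forces Δ = v - 1, so the Haemers bound collapses to v
-- as soon as γ₁' γᵥ' ≠ 0, while s = v is excluded by x = 0: an edge has two ends,
-- one of which is not universal, whence λ ≤ v - 3 and CA(0, v, k, λ) < 0.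
--
-- For γ₁' γᵥ' ≠ 0, a symmetric real matrix M whose quadratic form is positive
-- somewhere has a positive eigenvalue, namely the supremum μ of the Rayleigh
-- quotients. Completing squares shows that a positive semidefinite form either
-- has a nonzero null vector or dominates a positive multiple of |x|². The second
-- alternative for μ I - M contradicts the choice of μ, and the first one gives
-- an eigenvector. A nonzero symmetric matrix with zero diagonal cannot be
-- semidefinite, so both signs of eigenvalues occur for the complement of Γ, which
-- has an edge because some vertex of Γ is not universal.

-- The homomorphism from the integers and a ring solver with integer coefficients.

module IntegerCoefficients (ℝ : CompleteOrderedField) where
  open CompleteOrderedField ℝ
  open RingProperties ring
  open SemiringMult semiring using (×-homo-+; ×1-homo-*)
  open SetoidReasoning setoid

  fromℕ-+ : ∀ m n → fromℕ (m ℕ.+ n) ≈ fromℕ m + fromℕ n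
  fromℕ-+ = ×-homo-+ 1#

  -- Integers of opposite signs are added through `⊖`, so the mixed cases of `fromℤ-+` rest on this.
  -- The step cancels one `1#` from each side.
  fromℤ-⊖ : ∀ m n → fromℤ (m ℤ.⊖ n) ≈ fromℕ m - fromℕ n
  fromℤ-⊖ m       0       = sym (trans (+-congˡ -0#≈0#) (+-identityʳ _))
  fromℤ-⊖ 0       (suc n) = sym (+-identityˡ _)
  fromℤ-⊖ (suc m) (suc n) = begin
    fromℤ (suc m ℤ.⊖ suc n)                        ≡⟨ ≡.cong fromℤ (ℤ.[1+m]⊖[1+n]≡m⊖n m n) ⟩
    fromℤ (m ℤ.⊖ n)                                ≈⟨ fromℤ-⊖ m n ⟩
    fromℕ m - fromℕ n                              ≈⟨ +-congʳ (xyx⁻¹≈y 1# (fromℕ m)) ⟨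
    1# + fromℕ m - 1# - fromℕ n                    ≈⟨ +-assoc _ _ _ ⟩
    1# + fromℕ m + (- 1# - fromℕ n)                ≈⟨ +-congˡ (-‿+-comm 1# (fromℕ n)) ⟩
    fromℕ (suc m) - fromℕ (suc n)                  ∎

  fromℤ-neg : ∀ i → fromℤ (ℤ.- i) ≈ - fromℤ i
  fromℤ-neg (+ 0)       = sym -0#≈0#
  fromℤ-neg (+ (suc n)) = refl
  fromℤ-neg (-[1+ n ])  = sym (-‿involutive _)

  fromℤ-+ : ∀ i j → fromℤ (i ℤ.+ j) ≈ fromℤ i + fromℤ j
  fromℤ-+ (+ m)    (+ n)    = fromℕ-+ m n
  fromℤ-+ (+ m)    -[1+ n ] = fromℤ-⊖ m (suc n)
  fromℤ-+ -[1+ m ] (+ n)    = trans (fromℤ-⊖ n (suc m)) (+-comm _ _)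
  fromℤ-+ -[1+ m ] -[1+ n ] = begin
    - fromℕ (suc (suc (m ℕ.+ n)))      ≡⟨ ≡.cong (λ k → - fromℕ (suc k)) (ℕ.+-suc m n) ⟨
    - fromℕ (suc m ℕ.+ suc n)          ≈⟨ -‿cong (fromℕ-+ (suc m) (suc n)) ⟩
    - (fromℕ (suc m) + fromℕ (suc n))  ≈⟨ -‿+-comm _ _ ⟨
    - fromℕ (suc m) - fromℕ (suc n)    ∎

  fromℤ-*-+ : ∀ m j → fromℤ (+ m ℤ.* j) ≈ fromℕ m * fromℤ j
  fromℤ-*-+ m (+ n)    = trans (reflexive (≡.cong fromℤ (≡.sym (ℤ.pos-* m n)))) (×1-homo-* m n)
  fromℤ-*-+ m -[1+ n ] = begin
    fromℤ (+ m ℤ.* ℤ.- + suc n)   ≡⟨ ≡.cong fromℤ (ℤ.neg-distribʳ-* (+ m) (+ suc n)) ⟨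
    fromℤ (ℤ.- (+ m ℤ.* + suc n)) ≈⟨ fromℤ-neg (+ m ℤ.* + suc n) ⟩
    - fromℤ (+ m ℤ.* + suc n)     ≈⟨ -‿cong (fromℤ-*-+ m (+ suc n)) ⟩
    - (fromℕ m * fromℕ (suc n))   ≈⟨ -‿distribʳ-* _ _ ⟩
    fromℕ m * - fromℕ (suc n)     ∎

  fromℤ-* : ∀ i j → fromℤ (i ℤ.* j) ≈ fromℤ i * fromℤ j
  fromℤ-* (+ m)    j = fromℤ-*-+ m j
  fromℤ-* -[1+ m ] j = begin
    fromℤ (ℤ.- + suc m ℤ.* j)    ≡⟨ ≡.cong fromℤ (ℤ.neg-distribˡ-* (+ suc m) j) ⟨
    fromℤ (ℤ.- (+ suc m ℤ.* j))  ≈⟨ fromℤ-neg (+ suc m ℤ.* j) ⟩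
    - fromℤ (+ suc m ℤ.* j)      ≈⟨ -‿cong (fromℤ-*-+ (suc m) j) ⟩
    - (fromℕ (suc m) * fromℤ j)  ≈⟨ -‿distribˡ-* _ _ ⟩
    - fromℕ (suc m) * fromℤ j    ∎

  -- Integer coefficients have decidable equality, which lets the solver collect like terms over an
  -- abstract field. A constant `con (+ n)` denotes `fromℕ n` on the nose, and `fromℕ 1` is
  -- `1# + 0#`; this is why many formulas below contain `fromℕ 1` in place of `1#`.
  fromℤ-morphism : ℤ.+-*-rawRing -Raw-AlmostCommutative⟶ fromCommutativeRing commutativeRing
  fromℤ-morphism = record
    { ⟦_⟧    = fromℤ
    ; +-homo = fromℤ-+
    ; *-homo = fromℤ-*
    ; -‿homo = fromℤ-neg
    ; 0-homo = refl
    ; 1-homo = +-identityʳ 1#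
    }

  module Solver = RingSolver ℤ.+-*-rawRing (fromCommutativeRing commutativeRing) fromℤ-morphism
    (λ i j → map (λ i≡j → reflexive (≡.cong fromℤ i≡j)) (dec⇒weaklyDec ℤ._≟_ i j))

-- Order and sign rules in an ordered field.

module Order (ℝ : CompleteOrderedField) where
  open CompleteOrderedField ℝ
  open IntegerCoefficients ℝ
  open Solver using (solve; con; _:=_; _:+_; _:*_; _:-_; :-_)
  open SetoidReasoning setoid

  module < = IsStrictTotalOrder <-isStrictTotalOrder
  open < public using () renaming (_≟_ to _≈?_)

  ≤-trans : ∀ {x y z} → x ≤ y → y ≤ z → x ≤ z
  ≤-trans = StrictToNonStrict.trans _≈_ _<_ isEquivalence <.<-resp-≈ <.trans

  <-≤-trans : ∀ {x y z} → x < y → y ≤ z → x < z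
  <-≤-trans = StrictToNonStrict.<-≤-trans _≈_ _<_ <.trans (proj₁ <.<-resp-≈)

  ≤-<-trans : ∀ {x y z} → x ≤ y → y < z → x < z
  ≤-<-trans = StrictToNonStrict.≤-<-trans _≈_ _<_ sym <.trans (proj₂ <.<-resp-≈)

  ≈-<-trans : ∀ {x y z} → x ≈ y → y < z → x < z
  ≈-<-trans x≈y = ≤-<-trans (inj₂ x≈y)

  <-≈-trans : ∀ {x y z} → x < y → y ≈ z → x < z
  <-≈-trans x<y y≈z = <-≤-trans x<y (inj₂ y≈z)

  <⇒≱ : ∀ {x y} → x < y → ¬ (y ≤ x)
  <⇒≱ x<y y≤x = <.irrefl refl (<-≤-trans x<y y≤x)

  ≮⇒≥ : ∀ {x y} → ¬ (x < y) → y ≤ x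
  ≮⇒≥ {x} {y} x≮y with <.compare x y
  ... | tri< x<y _ _ = contradiction x<y x≮y
  ... | tri≈ _ x≈y _ = inj₂ (sym x≈y)
  ... | tri> _ _ y<x = inj₁ y<x

  ≰⇒> : ∀ {x y} → ¬ (x ≤ y) → y < x
  ≰⇒> {x} {y} x≰y with <.compare y x
  ... | tri< y<x _ _ = y<x
  ... | tri≈ _ y≈x _ = contradiction (inj₂ (sym y≈x)) x≰y
  ... | tri> _ _ x<y = contradiction (inj₁ x<y) x≰y

  <⇒0<- : ∀ {x y} → x < y → 0# < y - x
  <⇒0<- {x} {y} x<y = ≈-<-trans (sym (-‿inverseʳ x)) (+-monoˡ-< (- x) x<y)

  ≤⇒0≤- : ∀ {x y} → x ≤ y → 0# ≤ y - x
  ≤⇒0≤- (inj₁ x<y) = inj₁ (<⇒0<- x<y)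
  ≤⇒0≤- {x} (inj₂ x≈y) = inj₂ (trans (sym (-‿inverseʳ x)) (+-congʳ x≈y))

  x<x+d : ∀ x {d} → 0# < d → x < x + d
  x<x+d x {d} 0<d = ≈-<-trans (sym (+-identityˡ x)) (<-≈-trans (+-monoˡ-< x 0<d) (+-comm d x))

  x≤x+d : ∀ x {d} → 0# ≤ d → x ≤ x + d
  x≤x+d x (inj₁ 0<d) = inj₁ (x<x+d x 0<d)
  x≤x+d x (inj₂ 0≈d) = inj₂ (trans (sym (+-identityʳ x)) (+-congˡ 0≈d))

  -- The pattern of most inequalities below: `d` is a sum of visibly nonnegative terms, and the
  -- equation is a ring identity left to the solver.
  ≤-by : ∀ {x y d} → 0# ≤ d → x + d ≈ y → x ≤ y
  ≤-by {x} 0≤d x+d≈y = ≤-trans (x≤x+d x 0≤d) (inj₂ x+d≈y)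

  <-by : ∀ {x y d} → 0# < d → x + d ≈ y → x < y
  <-by {x} 0<d x+d≈y = <-≈-trans (x<x+d x 0<d) x+d≈y

  0≤+ : ∀ {x y} → 0# ≤ x → 0# ≤ y → 0# ≤ x + y
  0≤+ {x} 0≤x 0≤y = ≤-trans 0≤x (x≤x+d x 0≤y)

  0<+ : ∀ {x y} → 0# < x → 0# ≤ y → 0# < x + y
  0<+ {x} 0<x 0≤y = <-≤-trans 0<x (x≤x+d x 0≤y)

  0≤* : ∀ {x y} → 0# ≤ x → 0# ≤ y → 0# ≤ x * y
  0≤* (inj₁ 0<x) (inj₁ 0<y) = inj₁ (*-pos 0<x 0<y)
  0≤* {x} {y} (inj₂ 0≈x) _ = inj₂ (trans (sym (zeroˡ y)) (*-congʳ 0≈x))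
  0≤* {x} {y} _ (inj₂ 0≈y) = inj₂ (trans (sym (zeroʳ x)) (*-congˡ 0≈y))

  <0⇒0<- : ∀ {x} → x < 0# → 0# < - x
  <0⇒0<- {x} x<0 = <-≈-trans (<⇒0<- x<0) (+-identityˡ (- x))

  ≤0⇒0≤- : ∀ {x} → x ≤ 0# → 0# ≤ - x
  ≤0⇒0≤- {x} x≤0 = ≤-trans (≤⇒0≤- x≤0) (inj₂ (+-identityˡ (- x)))

  0<x² : ∀ {x} → x ≉ 0# → 0# < x * x
  0<x² {x} x≉0 with <.compare x 0#
  ... | tri< x<0 _ _ = <-≈-trans (*-pos (<0⇒0<- x<0) (<0⇒0<- x<0))
                         (solve 1 (λ x → :- x :* :- x := x :* x) refl x)
  ... | tri≈ _ x≈0 _ = contradiction x≈0 x≉0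
  ... | tri> _ _ 0<x = *-pos 0<x 0<x

  0≤x² : ∀ x → 0# ≤ x * x
  0≤x² x with x ≈? 0#
  ... | yes x≈0 = inj₂ (sym (trans (*-congʳ x≈0) (zeroˡ x)))
  ... | no x≉0  = inj₁ (0<x² x≉0)

  x²≤0⇒x≈0 : ∀ {x} → x * x ≤ 0# → x ≈ 0#
  x²≤0⇒x≈0 {x} x²≤0 = decidable-stable (x ≈? 0#) (λ x≉0 → <⇒≱ (0<x² x≉0) x²≤0)

  0<1 : 0# < 1#
  0<1 = <-≈-trans (0<x² (0≉1 ∘ sym)) (*-identityˡ 1#)

  0≤fromℕ : ∀ n → 0# ≤ fromℕ n
  0≤fromℕ 0       = inj₂ refl
  0≤fromℕ (suc n) = 0≤+ (inj₁ 0<1) (0≤fromℕ n)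

  0<fromℕ-suc : ∀ n → 0# < fromℕ (suc n)
  0<fromℕ-suc n = 0<+ 0<1 (0≤fromℕ n)

  fromℕ-mono-< : ∀ {m n} → m ℕ.< n → fromℕ m < fromℕ n
  fromℕ-mono-< {m} m<n with d , ≡.refl ← ℕ.m≤n⇒∃[o]m+o≡n m<n =
    <-by (0<fromℕ-suc d) (trans (sym (fromℕ-+ m (suc d))) (reflexive (≡.cong fromℕ (ℕ.+-suc m d))))

  inverse⁺ : ∀ {x} → 0# < x → ∃[ y ] x * y ≈ 1# × 0# < y
  inverse⁺ {x} 0<x with y , xy≈1 ← inverse x (λ x≈0 → <.irrefl (sym x≈0) 0<x) =
    -- If `y ≤ 0#`, adding the nonnegative number `x * - y` to `1# ≈ x * y` gives zero, so
    -- `1# ≤ 0#`.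
    y , xy≈1 , ≰⇒> λ y≤0 → <⇒≱ 0<1
      (≤-by (0≤* (inj₁ 0<x) (≤0⇒0≤- y≤0))
        (trans (+-congʳ (sym xy≈1)) (solve 2 (λ x y → x :* y :+ x :* :- y := con (+ 0)) refl x y)))

  xy≈0⇒x≈0∨y≈0 : ∀ {x y} → x * y ≈ 0# → x ≈ 0# ⊎ y ≈ 0#
  xy≈0⇒x≈0∨y≈0 {x} {y} xy≈0 with x ≈? 0#
  ... | yes x≈0 = inj₁ x≈0
  ... | no x≉0 with z , xz≈1 ← inverse x x≉0 = inj₂ (begin
    y            ≈⟨ *-identityˡ y ⟨
    1# * y       ≈⟨ *-congʳ xz≈1 ⟨
    x * z * y    ≈⟨ solve 3 (λ x y z → x :* z :* y := z :* (x :* y)) refl x y z ⟩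
    z * (x * y)  ≈⟨ *-congˡ xy≈0 ⟩
    z * 0#       ≈⟨ zeroʳ z ⟩
    0#           ∎)

-- Symmetric bilinear and quadratic forms.

module QuadraticForms (ℝ : CompleteOrderedField) where
  open CompleteOrderedField ℝ hiding (zero)
  open IntegerCoefficients ℝ
  open Solver using (solve; con; _:=_; _:+_; _:*_; _:-_; :-_)
  open Order ℝ
  open SemiringSum semiring using (sum-cong-≋; *-distribˡ-sum; ∑-comm)
  open SetoidReasoning setoid

  private variable n : ℕ

  infixl 7 _∙_ _·_
  infix 4 _≋_

  _≋_ : (x y : Vector Carrier n) → Set
  x ≋ y = ∀ i → x i ≈ y i

  _∙_ : (x y : Vector Carrier n) → Carrier
  x ∙ y = sum (λ i → x i * y i)

  _·_ : Matrix ℝ n → Vector Carrier n → Vector Carrier n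
  (M · x) i = M i ∙ x

  quad : Matrix ℝ n → Vector Carrier n → Carrier
  quad M x = x ∙ (M · x)

  -- Serves for vectors and for rows of matrices alike, so that linearity of `∙` also computes the
  -- forms of `schur` and `shift`.
  linComb : (c : Carrier) (x : Vector Carrier n) (d : Carrier) (y : Vector Carrier n) → Vector Carrier n
  linComb c x d y i = c * x i + d * y i

  Symmetric : Matrix ℝ n → Set
  Symmetric M = ∀ i j → M i j ≈ M j i

  ∙-cong : {x x′ y y′ : Vector Carrier n} → x ≋ x′ → y ≋ y′ → x ∙ y ≈ x′ ∙ y′
  ∙-cong x≋x′ y≋y′ = sum-cong-≋ (λ i → *-cong (x≋x′ i) (y≋y′ i))

  ∙-congʳ : (x : Vector Carrier n) {y y′ : Vector Carrier n} → y ≋ y′ → x ∙ y ≈ x ∙ y′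
  ∙-congʳ x = ∙-cong (λ _ → refl)

  ∙-comm : (x y : Vector Carrier n) → x ∙ y ≈ y ∙ x
  ∙-comm x y = sum-cong-≋ (λ i → *-comm (x i) (y i))

  ∙-linCombʳ : ∀ (x : Vector Carrier n) c u d w → x ∙ linComb c u d w ≈ c * (x ∙ u) + d * (x ∙ w)
  ∙-linCombʳ {0}     x c u d w = solve 2 (λ c d → con (+ 0) := c :* con (+ 0) :+ d :* con (+ 0)) refl c d
  ∙-linCombʳ {suc n} x c u d w = begin
    x zero * (c * u zero + d * w zero) + tail x ∙ linComb c (tail u) d (tail w)
      ≈⟨ +-congˡ (∙-linCombʳ (tail x) c (tail u) d (tail w)) ⟩
    x zero * (c * u zero + d * w zero) + (c * (tail x ∙ tail u) + d * (tail x ∙ tail w))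
      ≈⟨ solve 7 (λ x c u d w U W → x :* (c :* u :+ d :* w) :+ (c :* U :+ d :* W) :=
                                    c :* (x :* u :+ U) :+ d :* (x :* w :+ W))
           refl (x zero) c (u zero) d (w zero) (tail x ∙ tail u) (tail x ∙ tail w) ⟩
    c * (x ∙ u) + d * (x ∙ w) ∎

  ∙-linCombˡ : ∀ c u d w (x : Vector Carrier n) → linComb c u d w ∙ x ≈ c * (u ∙ x) + d * (w ∙ x)
  ∙-linCombˡ c u d w x = begin
    linComb c u d w ∙ x             ≈⟨ ∙-comm (linComb c u d w) x ⟩
    x ∙ linComb c u d w             ≈⟨ ∙-linCombʳ x c u d w ⟩
    c * (x ∙ u) + d * (x ∙ w)  ≈⟨ +-cong (*-congˡ (∙-comm x u)) (*-congˡ (∙-comm x w)) ⟩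
    c * (u ∙ x) + d * (w ∙ x)  ∎

  ∙-zeroʳ : (x : Vector Carrier n) → x ∙ replicate n 0# ≈ 0#
  ∙-zeroʳ {0}     x = refl
  ∙-zeroʳ {suc n} x = trans (+-cong (zeroʳ (x zero)) (∙-zeroʳ (tail x))) (+-identityʳ 0#)

  0≤x∙x : (x : Vector Carrier n) → 0# ≤ x ∙ x
  0≤x∙x {0}     x = inj₂ refl
  0≤x∙x {suc n} x = 0≤+ (0≤x² (x zero)) (0≤x∙x (tail x))

  x∙x≤0⇒x≋0 : (x : Vector Carrier n) → x ∙ x ≤ 0# → ∀ i → x i ≈ 0#
  x∙x≤0⇒x≋0 x x∙x≤0 zero    = x²≤0⇒x≈0 (≤-trans (x≤x+d _ (0≤x∙x (tail x))) x∙x≤0)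
  x∙x≤0⇒x≋0 x x∙x≤0 (suc i) = x∙x≤0⇒x≋0 (tail x)
    (≤-trans (≤-by (0≤x² (x zero)) (+-comm (tail x ∙ tail x) (x zero * x zero))) x∙x≤0) i

  unit : Fin n → Vector Carrier n
  unit {suc n} zero    = 1# ∷ replicate n 0#
  unit         (suc i) = 0# ∷ unit i

  unit-sym : (i j : Fin n) → unit i j ≈ unit j i
  unit-sym zero    zero    = refl
  unit-sym zero    (suc j) = refl
  unit-sym (suc i) zero    = refl
  unit-sym (suc i) (suc j) = unit-sym i j

  ∙-unit : (x : Vector Carrier n) (i : Fin n) → x ∙ unit i ≈ x i
  ∙-unit x zero    = trans (+-cong (*-identityʳ (x zero)) (∙-zeroʳ (tail x))) (+-identityʳ (x zero))
  ∙-unit x (suc i) = trans (+-cong (zeroʳ (x zero)) (∙-unit (tail x) i)) (+-identityˡ (x (suc i)))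

  unit≢0 : (i : Fin n) → ¬ (∀ j → unit i j ≈ 0#)
  unit≢0 zero    unit≋0 = 0≉1 (sym (unit≋0 zero))
  unit≢0 (suc i) unit≋0 = unit≢0 i (unit≋0 ∘ suc)

  quad-unit : (M : Matrix ℝ n) (i : Fin n) → quad M (unit i) ≈ M i i
  quad-unit M i = trans (∙-comm (unit i) (M · unit i)) (trans (∙-unit (M · unit i) i) (∙-unit (M i) i))

  -- Interchange of the two summations; symmetry of `M` then swaps the indices.
  ∙-adjoint : {M : Matrix ℝ n} → Symmetric M → ∀ x y → x ∙ (M · y) ≈ y ∙ (M · x)
  ∙-adjoint {M = M} M-sym x y = begin
    x ∙ (M · y)
      ≈⟨ sum-cong-≋ (λ i → *-distribˡ-sum (x i) (λ j → M i j * y j)) ⟩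
    sum (λ i → sum (λ j → x i * (M i j * y j)))
      ≈⟨ ∑-comm (λ i j → x i * (M i j * y j)) ⟩
    sum (λ j → sum (λ i → x i * (M i j * y j)))
      ≈⟨ sum-cong-≋ (λ j → sum-cong-≋ (λ i → trans
           (solve 3 (λ x m y → x :* (m :* y) := y :* (m :* x)) refl (x i) (M i j) (y j))
           (*-congˡ (*-congʳ (M-sym i j))))) ⟩
    sum (λ j → sum (λ i → y j * (M j i * x i)))
      ≈⟨ sum-cong-≋ (λ j → *-distribˡ-sum (y j) (λ i → M j i * x i)) ⟨
    y ∙ (M · x) ∎

  -- The two cross terms coincide by `∙-adjoint`, whence the factor 2.
  quad-linComb : {M : Matrix ℝ n} → Symmetric M → ∀ c x d y →
            quad M (linComb c x d y) ≈ c * c * quad M x + fromℕ 2 * c * d * (y ∙ (M · x)) + d * d * quad M y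
  quad-linComb {M = M} M-sym c x d y = begin
    quad M (linComb c x d y)
      ≈⟨ ∙-linCombˡ c x d y _ ⟩
    c * (x ∙ (M · linComb c x d y)) + d * (y ∙ (M · linComb c x d y))
      ≈⟨ +-cong (*-congˡ (expand x)) (*-congˡ (expand y)) ⟩
    c * (c * quad M x + d * (x ∙ (M · y))) + d * (c * (y ∙ (M · x)) + d * quad M y)
      ≈⟨ +-congʳ (*-congˡ (+-congˡ (*-congˡ (∙-adjoint M-sym x y)))) ⟩
    c * (c * quad M x + d * (y ∙ (M · x))) + d * (c * (y ∙ (M · x)) + d * quad M y)
      ≈⟨ solve 5 (λ c d p q r → c :* (c :* p :+ d :* q) :+ d :* (c :* q :+ d :* r) :=
                   c :* c :* p :+ con (+ 2) :* c :* d :* q :+ d :* d :* r)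
           refl c d (quad M x) (y ∙ (M · x)) (quad M y) ⟩
    c * c * quad M x + fromℕ 2 * c * d * (y ∙ (M · x)) + d * d * quad M y ∎
    where
    expand : ∀ z → z ∙ (M · linComb c x d y) ≈ c * (z ∙ (M · x)) + d * (z ∙ (M · y))
    expand z = trans (∙-congʳ z (λ i → ∙-linCombʳ (M i) c x d y)) (∙-linCombʳ z c (M · x) d (M · y))

  PositiveSemidefinite : Matrix ℝ n → Set
  PositiveSemidefinite M = ∀ x → 0# ≤ quad M x

  -- With p = |Mx|² and q = quad M (Mx), evaluating the form at (q + 1)x - p(Mx)
  -- gives - p²(q + 2), which must be nonnegative.
  null⇒kernel : {M : Matrix ℝ n} → Symmetric M → PositiveSemidefinite M →
                ∀ x → quad M x ≈ 0# → ∀ i → (M · x) i ≈ 0#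
  null⇒kernel {M = M} M-sym M-psd x null = x∙x≤0⇒x≋0 y (inj₂ (x²≤0⇒x≈0 p²≤0))
    where
    y = M · x
    p = y ∙ y
    q = quad M y

    value : quad M (linComb (q + fromℕ 1) x (- p) y) ≈ - (p * p * (q + fromℕ 2))
    value = begin
      quad M (linComb (q + fromℕ 1) x (- p) y)
        ≈⟨ quad-linComb M-sym (q + fromℕ 1) x (- p) y ⟩
      (q + fromℕ 1) * (q + fromℕ 1) * quad M x + fromℕ 2 * (q + fromℕ 1) * - p * p + - p * - p * q
        ≈⟨ +-congʳ (+-congʳ (*-congˡ null)) ⟩
      (q + fromℕ 1) * (q + fromℕ 1) * 0# + fromℕ 2 * (q + fromℕ 1) * - p * p + - p * - p * q
        ≈⟨ solve 2 (λ p q → (q :+ con (+ 1)) :* (q :+ con (+ 1)) :* con (+ 0)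
                             :+ con (+ 2) :* (q :+ con (+ 1)) :* :- p :* p :+ :- p :* :- p :* q
                             := :- (p :* p :* (q :+ con (+ 2)))) refl p q ⟩
      - (p * p * (q + fromℕ 2)) ∎

    p²≤0 : p * p ≤ 0#
    p²≤0 = ≮⇒≥ λ 0<p² →
      <⇒≱ (*-pos 0<p² (<-≈-trans (0<+ (0<fromℕ-suc 1) (M-psd y)) (+-comm (fromℕ 2) q)))
          (≤-by (M-psd (linComb (q + fromℕ 1) x (- p) y)) (trans (+-congˡ value) (-‿inverseʳ _)))

  -- Splitting off the first coordinate, and the Schur complement.

  module Bordered (M : Matrix ℝ (suc n)) (M-sym : Symmetric M) where
    corner : Carrier
    corner = M zero zero

    border : Vector Carrier n
    border = tail (M zero)

    minor : Matrix ℝ n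
    minor i = tail (M (suc i))

    minor-sym : Symmetric minor
    minor-sym i j = M-sym (suc i) (suc j)

    quad-bordered : ∀ x → quad M x ≈
      corner * (x zero * x zero) + fromℕ 2 * (x zero * (border ∙ tail x)) + quad minor (tail x)
    quad-bordered x = begin
      x₀ * (corner * x₀ + β) + y ∙ (λ i → M (suc i) zero * x₀ + (minor · y) i)
        ≈⟨ +-congˡ (∙-congʳ y λ i →
             trans (+-congʳ (trans (*-congʳ (M-sym (suc i) zero)) (*-comm _ x₀)))
                   (+-congˡ (sym (trans (*-congʳ (+-identityʳ 1#)) (*-identityˡ _))))) ⟩
      x₀ * (corner * x₀ + β) + y ∙ linComb x₀ border (fromℕ 1) (minor · y)
        ≈⟨ +-congˡ (∙-linCombʳ y x₀ border (fromℕ 1) (minor · y)) ⟩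
      x₀ * (corner * x₀ + β) + (x₀ * (y ∙ border) + fromℕ 1 * quad minor y)
        ≈⟨ +-congˡ (+-congʳ (*-congˡ (∙-comm y border))) ⟩
      x₀ * (corner * x₀ + β) + (x₀ * β + fromℕ 1 * quad minor y)
        ≈⟨ solve 4 (λ a x β q → x :* (a :* x :+ β) :+ (x :* β :+ con (+ 1) :* q) :=
                                a :* (x :* x) :+ con (+ 2) :* (x :* β) :+ q)
             refl corner x₀ β (quad minor y) ⟩
      corner * (x₀ * x₀) + fromℕ 2 * (x₀ * β) + quad minor y ∎
      where
      x₀ = x zero
      y = tail x
      β = border ∙ y

    -- The Schur complement of `corner` multiplied by `corner`, that is `corner` times `minor` minus
    -- the outer square of `border`. The scaling makes it free of division.
    schur : Matrix ℝ n
    schur i = linComb corner (minor i) (- border i) border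

    schur-sym : Symmetric schur
    schur-sym i j = +-cong (*-congˡ (minor-sym i j))
      (solve 2 (λ b c → :- b :* c := :- c :* b) refl (border i) (border j))

    quad-schur : ∀ y → quad schur y ≈ corner * quad minor y - (border ∙ y) * (border ∙ y)
    quad-schur y = begin
      quad schur y
        ≈⟨ ∙-congʳ y (λ i → trans (∙-linCombˡ corner (minor i) (- border i) border y)
             (+-congˡ (solve 2 (λ b β → :- b :* β := :- β :* b) refl (border i) β))) ⟩
      y ∙ linComb corner (minor · y) (- β) border
        ≈⟨ ∙-linCombʳ y corner (minor · y) (- β) border ⟩
      corner * quad minor y + - β * (y ∙ border)
        ≈⟨ +-congˡ (*-congˡ (∙-comm y border)) ⟩
      corner * quad minor y + - β * β
        ≈⟨ solve 3 (λ a q β → a :* q :+ :- β :* β := a :* q :- β :* β) refl corner (quad minor y) β ⟩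
      corner * quad minor y - β * β ∎
      where β = border ∙ y

    -- With a = `corner` and β = `border ∙ tail x`, this is a(ax² + 2xβ + q) = (ax + β)² + (aq -
    -- β²), whose last bracket is the form of `schur`.
    complete-square : ∀ x → let u = corner * x zero + border ∙ tail x in
                      corner * quad M x ≈ u * u + quad schur (tail x)
    complete-square x = begin
      corner * quad M x
        ≈⟨ *-congˡ (quad-bordered x) ⟩
      corner * (corner * (x zero * x zero) + fromℕ 2 * (x zero * β) + q)
        ≈⟨ solve 4 (λ a x β q → a :* (a :* (x :* x) :+ con (+ 2) :* (x :* β) :+ q) :=
                     (a :* x :+ β) :* (a :* x :+ β) :+ (a :* q :- β :* β)) refl corner (x zero) β q ⟩
      u * u + (corner * q - β * β)
        ≈⟨ +-congˡ (quad-schur (tail x)) ⟨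
      u * u + quad schur (tail x) ∎
      where
      β = border ∙ tail x
      q = quad minor (tail x)
      u = corner * x zero + β

  -- Upper and lower bounds for quadratic forms.

  -- A Cauchy-Schwarz inequality with a crude constant: the induction uses (p + q)² ≤ 2p² + 2q², the
  -- difference of the two sides being (p - q)².
  ∙-bounded : (b : Vector Carrier n) → ∃[ c ] 0# ≤ c × (∀ y → (b ∙ y) * (b ∙ y) ≤ c * (y ∙ y))
  ∙-bounded {0} b = 0# , inj₂ refl , λ y → inj₂ refl
  ∙-bounded {suc n} b with c , 0≤c , bounded ← ∙-bounded (tail b) =
    fromℕ 2 * (b₀ * b₀ + c) , 0≤* (0≤fromℕ 2) (0≤+ (0≤x² b₀) 0≤c) , λ y →
      let y₀ = y zero ; β = tail b ∙ tail y ; Y = tail y ∙ tail y in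
      ≤-by (0≤+ (0≤+ (0≤+ (0≤x² (b₀ * y₀ - β)) (0≤* (0≤fromℕ 2) (≤⇒0≤- (bounded (tail y)))))
                     (0≤* (0≤fromℕ 2) (0≤* 0≤c (0≤x² y₀))))
                (0≤* (0≤fromℕ 2) (0≤* (0≤x² b₀) (0≤x∙x (tail y)))))
        (solve 5 (λ b y β Y c →
             (b :* y :+ β) :* (b :* y :+ β)
               :+ ((b :* y :- β) :* (b :* y :- β) :+ con (+ 2) :* (c :* Y :- β :* β)
                   :+ con (+ 2) :* (c :* (y :* y)) :+ con (+ 2) :* (b :* b :* Y))
             := con (+ 2) :* (b :* b :+ c) :* (y :* y :+ Y))
           refl b₀ y₀ β Y c)
    where b₀ = b zero

  nonneg-bound : ∀ a → ∃[ c ] 0# ≤ c × a ≤ c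
  nonneg-bound a with <.compare 0# a
  ... | tri< 0<a _ _ = a , inj₁ 0<a , inj₂ refl
  ... | tri≈ _ 0≈a _ = 0# , inj₂ refl , inj₂ (sym 0≈a)
  ... | tri> _ _ a<0 = 0# , inj₂ refl , inj₁ a<0

  -- Bounds the Rayleigh quotients from above, so that their supremum exists. The mixed term
  -- satisfies 2x₀β ≤ x₀² + β²; here x₀² accounts for `fromℕ 1` in the constant and β² for `d`.
  quad-bounded : (M : Matrix ℝ n) → Symmetric M → ∃[ c ] 0# ≤ c × (∀ x → quad M x ≤ c * (x ∙ x))
  quad-bounded {0} M M-sym = 0# , inj₂ refl , λ x → inj₂ (sym (zeroˡ 0#))
  quad-bounded {suc n} M M-sym
    with a⁺ , 0≤a⁺ , a≤a⁺ ← nonneg-bound (M zero zero)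
       | c , 0≤c , minor-bounded ← quad-bounded (Bordered.minor M M-sym) (Bordered.minor-sym M M-sym)
       | d , 0≤d , border-bounded ← ∙-bounded (Bordered.border M M-sym) =
    a⁺ + fromℕ 1 + d + c , 0≤+ (0≤+ (0≤+ 0≤a⁺ (0≤fromℕ 1)) 0≤d) 0≤c , λ x →
      let x₀ = x zero ; y = tail x ; β = border ∙ y ; Y = y ∙ y ; q = quad minor y in
      ≤-by (0≤+ (0≤+ (0≤+ (0≤+ (0≤+ (0≤+
                 (0≤* (≤⇒0≤- a≤a⁺) (0≤x² x₀))
                 (0≤x² (x₀ - β)))
                 (≤⇒0≤- (border-bounded y)))
                 (≤⇒0≤- (minor-bounded y)))
                 (0≤* (0≤+ 0≤a⁺ (0≤fromℕ 1)) (0≤x∙x y)))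
                 (0≤* 0≤d (0≤x² x₀)))
                 (0≤* 0≤c (0≤x² x₀)))
        (trans (+-congʳ (quad-bordered x))
          (solve 8 (λ a a⁺ d c x β Y q →
               a :* (x :* x) :+ con (+ 2) :* (x :* β) :+ q
                 :+ ((a⁺ :- a) :* (x :* x) :+ (x :- β) :* (x :- β) :+ (d :* Y :- β :* β) :+ (c :* Y :- q)
                     :+ (a⁺ :+ con (+ 1)) :* Y :+ d :* (x :* x) :+ c :* (x :* x))
               := (a⁺ :+ con (+ 1) :+ d :+ c) :* (x :* x :+ Y))
             refl corner a⁺ d c x₀ β Y q))
    where open Bordered M M-sym

  Nonzero : Vector Carrier n → Set
  Nonzero x = ¬ (∀ i → x i ≈ 0#)

  -- Stands in for the compactness of the unit sphere, by induction on the dimension. The corner is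
  -- the value of the form at the first unit vector: it cannot be negative, and if it is zero, that
  -- vector is null. If it is positive, completing the square passes to the Schur complement.
  null-or-coercive : (M : Matrix ℝ n) → Symmetric M → PositiveSemidefinite M →
    (∃[ x ] Nonzero x × quad M x ≈ 0#) ⊎
    (∃[ L ] 0# < L × (∀ x → x ∙ x ≤ L * quad M x))
  null-or-coercive {0} M M-sym M-psd = inj₂ (1# , 0<1 , λ x → inj₂ (sym (zeroʳ 1#)))
  null-or-coercive {suc n} M M-sym M-psd with <.compare 0# (M zero zero)
  ... | tri≈ _ 0≈a _ = inj₁ (unit zero , unit≢0 zero , trans (quad-unit M zero) (sym 0≈a))
  ... | tri> _ _ a<0 = contradiction (≤-trans (M-psd (unit zero)) (inj₂ (quad-unit M zero))) (<⇒≱ a<0)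
  ... | tri< 0<a _ _ with i , ai≈1 , 0<i ← inverse⁺ 0<a =
    Sum.map extend coercive (null-or-coercive schur schur-sym schur-psd)
    where
    open Bordered M M-sym
    -- The extension of `y` by the first coordinate at which the completed square vanishes. The form
    -- is least there among all extensions of `y`, and its value is that of `schur` up to the factor
    -- `corner`.
    minimiser : Vector Carrier n → Vector Carrier (suc n)
    minimiser y = - (border ∙ y * i) ∷ y

    quad-minimiser : ∀ y → corner * quad M (minimiser y) ≈ quad schur y
    quad-minimiser y = begin
      corner * quad M (minimiser y)  ≈⟨ complete-square (minimiser y) ⟩
      u * u + quad schur y           ≈⟨ +-congʳ (*-congʳ u≈0) ⟩
      0# * u + quad schur y          ≈⟨ solve 2 (λ u q → con (+ 0) :* u :+ q := q) refl u (quad schur y) ⟩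
      quad schur y                   ∎
      where
      β = border ∙ y
      u = corner * - (β * i) + β
      u≈0 : u ≈ 0#
      u≈0 = begin
        corner * - (β * i) + β  ≈⟨ solve 3 (λ a β i → a :* :- (β :* i) :+ β := β :- a :* i :* β) refl corner β i ⟩
        β - corner * i * β      ≈⟨ +-congˡ (-‿cong (trans (*-congʳ ai≈1) (*-identityˡ β))) ⟩
        β - β                   ≈⟨ -‿inverseʳ β ⟩
        0#                      ∎

    schur-psd : PositiveSemidefinite schur
    schur-psd y = ≤-trans (0≤* (inj₁ 0<a) (M-psd (minimiser y))) (inj₂ (quad-minimiser y))

    extend : ∃[ y ] Nonzero y × quad schur y ≈ 0# → ∃[ x ] Nonzero x × quad M x ≈ 0#
    extend (y , y≉0 , null) = minimiser y , (λ x≈0 → y≉0 (x≈0 ∘ suc)) ,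
      Sum.fromInj₂ (λ a≈0 → contradiction 0<a (<.irrefl (sym a≈0)))
        (xy≈0⇒x≈0∨y≈0 (trans (quad-minimiser y) null))

    -- With u = a x₀ + b ∙ y one has a (quad M x) = u² + quad S y and
    -- a² x₀² ≤ 2u² + 2(b ∙ y)², which bounds a² |x|² by a multiple of a (quad M x).
    coercive : ∃[ L ] 0# < L × (∀ y → y ∙ y ≤ L * quad schur y) →
               ∃[ L ] 0# < L × (∀ x → x ∙ x ≤ L * quad M x)
    coercive (L , 0<L , schur-coercive) with c , 0≤c , border-bounded ← ∙-bounded border =
      i * K , *-pos 0<i 0<K , bound
      where
      a = corner
      -- The coefficient of |y|²: `fromℕ 2 * c` comes from 2(b ∙ y)² and `a * a` from the part
      -- a²|y|² of a²|x|². Below, `K` dominates both the coefficient 2 of u² and the coefficient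
      -- `k * L` of the Schur form.
      k = fromℕ 2 * c + a * a
      0≤k : 0# ≤ k
      0≤k = 0≤+ (0≤* (0≤fromℕ 2) 0≤c) (0≤x² a)
      K = fromℕ 2 + k * L
      0<K : 0# < K
      0<K = 0<+ (0<fromℕ-suc 1) (0≤* 0≤k (inj₁ 0<L))

      scaled-bound : ∀ x → a * a * (x ∙ x) ≤ K * (a * quad M x)
      scaled-bound x = ≤-by
        (0≤+ (0≤+ (0≤+ (0≤+ (0≤x² (u + β))
          (0≤* (0≤fromℕ 2) (≤⇒0≤- (border-bounded y))))
          (0≤* (0≤fromℕ 2) (schur-psd y)))
          (0≤* (0≤* 0≤k (inj₁ 0<L)) (0≤x² u)))
          (0≤* 0≤k (≤⇒0≤- (schur-coercive y))))
        (trans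
          (solve 7 (λ a x β Y c L q →
             let u = a :* x :+ β ; k = con (+ 2) :* c :+ a :* a in
             a :* a :* (x :* x :+ Y)
               :+ ((u :+ β) :* (u :+ β) :+ con (+ 2) :* (c :* Y :- β :* β) :+ con (+ 2) :* q
                   :+ k :* L :* (u :* u) :+ k :* (L :* q :- Y))
             := (con (+ 2) :+ k :* L) :* (u :* u :+ q)) refl a (x zero) β (y ∙ y) c L q)
          (*-congˡ (sym (complete-square x))))
        where
        y = tail x
        β = border ∙ y
        u = a * x zero + β
        q = quad schur y

      bound : ∀ x → x ∙ x ≤ i * K * quad M x
      bound x = ≤-by (0≤* (0≤x² i) (≤⇒0≤- (scaled-bound x))) (begin
        N + i * i * (K * (a * Q) - a * a * N)
          ≈⟨ solve 5 (λ i a N K Q → N :+ i :* i :* (K :* (a :* Q) :- a :* a :* N) :=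
               i :* K :* (a :* i) :* Q :+ N :- (a :* i) :* (a :* i) :* N) refl i a N K Q ⟩
        i * K * (a * i) * Q + N - a * i * (a * i) * N
          ≈⟨ +-cong (+-congʳ (*-congʳ (*-congˡ ai≈1))) (-‿cong (*-congʳ (*-cong ai≈1 ai≈1))) ⟩
        i * K * 1# * Q + N - 1# * 1# * N
          ≈⟨ +-cong (+-congʳ (*-congʳ (*-identityʳ _))) (-‿cong (trans (*-congʳ (*-identityˡ 1#)) (*-identityˡ N))) ⟩
        i * K * Q + N - N
          ≈⟨ solve 2 (λ p N → p :+ N :- N := p) refl (i * K * Q) N ⟩
        i * K * Q ∎)
        where
        N = x ∙ x
        Q = quad M x

-- Eigenvalues of symmetric matrices as extrema of Rayleigh quotients.

module Eigenvalues (ℝ : CompleteOrderedField) where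
  open CompleteOrderedField ℝ hiding (zero)
  open IntegerCoefficients ℝ
  open Solver using (solve; con; _:=_; _:+_; _:*_; _:-_; :-_)
  open Order ℝ
  open QuadraticForms ℝ
  open SetoidReasoning setoid

  private variable n : ℕ

  -- The matrix μ I - M, whose null vectors, once it is semidefinite, are eigenvectors of `M` for μ.
  shift : Carrier → Matrix ℝ n → Matrix ℝ n
  shift μ M i = linComb μ (unit i) (- fromℕ 1) (M i)

  shift-sym : ∀ μ {M : Matrix ℝ n} → Symmetric M → Symmetric (shift μ M)
  shift-sym μ M-sym i j = +-cong (*-congˡ (unit-sym i j)) (*-congˡ (M-sym i j))

  shift-· : ∀ μ (M : Matrix ℝ n) x i → (shift μ M · x) i ≈ linComb μ x (- fromℕ 1) (M · x) i
  shift-· μ M x i = trans (∙-linCombˡ μ (unit i) (- fromℕ 1) (M i) x)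
    (+-congʳ (*-congˡ (trans (∙-comm (unit i) x) (∙-unit x i))))

  quad-shift : ∀ μ (M : Matrix ℝ n) x → quad (shift μ M) x ≈ μ * (x ∙ x) - quad M x
  quad-shift μ M x = begin
    quad (shift μ M) x                   ≈⟨ ∙-congʳ x (shift-· μ M x) ⟩
    x ∙ linComb μ x (- fromℕ 1) (M · x)  ≈⟨ ∙-linCombʳ x μ x (- fromℕ 1) (M · x) ⟩
    μ * (x ∙ x) + - fromℕ 1 * quad M x
      ≈⟨ solve 3 (λ μ N Q → μ :* N :+ :- con (+ 1) :* Q := μ :* N :- Q) refl μ (x ∙ x) (quad M x) ⟩
    μ * (x ∙ x) - quad M x ∎

  positive-eigenvalue : {M : Matrix ℝ n} → Symmetric M → ∀ {x} → 0# < quad M x →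
                        ∃[ μ ] 0# < μ × IsEigenvalue ℝ M μ
  positive-eigenvalue {n} {M} M-sym {x⁺} 0<Q = μ , 0<μ , eigen (null-or-coercive (shift μ M) (shift-sym μ M-sym) psd)
    where
    -- The numbers strictly below some Rayleigh quotient, stated without division. The strict
    -- inequality fails at the zero vector, so such an `x` is nonzero automatically.
    Exceeded : Carrier → Set
    Exceeded t = ∃[ x ] t * (x ∙ x) < quad M x

    exceeded⇒≤ : ∀ {c} → (∀ x → quad M x ≤ c * (x ∙ x)) → ∀ t → Exceeded t → t ≤ c
    exceeded⇒≤ {c} bounded t (x , exceeds) = ≮⇒≥ λ c<t →
      <⇒≱ (<-≤-trans exceeds (bounded x))
        (≤-by (0≤* (≤⇒0≤- (inj₁ c<t)) (0≤x∙x x))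
          (solve 3 (λ c t N → c :* N :+ (t :- c) :* N := t :* N) refl c t (x ∙ x)))

    exceeded-bounded : ∃[ c ] (∀ t → Exceeded t → t ≤ c)
    exceeded-bounded with c , _ , bounded ← quad-bounded M M-sym = c , exceeded⇒≤ bounded

    supremum-exceeded = supremum Exceeded (0# , x⁺ , ≈-<-trans (zeroˡ _) 0<Q) exceeded-bounded

    μ : Carrier
    μ = proj₁ supremum-exceeded

    μ-upper : ∀ t → Exceeded t → t ≤ μ
    μ-upper = proj₁ (proj₂ supremum-exceeded)

    μ-least : ∀ b → (∀ t → Exceeded t → t ≤ b) → μ ≤ b
    μ-least = proj₂ (proj₂ supremum-exceeded)

    -- If μN < Q, then μ + (Q - μN)/(1 + N) is still exceeded at `x`, though it is larger than μ.
    -- The denominator 1 + N is positive for every `x`.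
    quad≤μ : ∀ x → quad M x ≤ μ * (x ∙ x)
    quad≤μ x = ≮⇒≥ λ μN<Q → let
        N = x ∙ x
        Q = quad M x
        j , 1+N*j≈1 , 0<j = inverse⁺ (0<+ (0<fromℕ-suc 0) (0≤x∙x x))
        0<dj = *-pos (<⇒0<- μN<Q) 0<j
      in <⇒≱ (x<x+d μ 0<dj) (μ-upper (μ + (Q - μ * N) * j) (x , <-by 0<dj (begin
           (μ + (Q - μ * N) * j) * N + (Q - μ * N) * j
             ≈⟨ solve 4 (λ μ Q N j → (μ :+ (Q :- μ :* N) :* j) :* N :+ (Q :- μ :* N) :* j
                                  := (Q :- μ :* N) :* ((con (+ 1) :+ N) :* j) :+ μ :* N) refl μ Q N j ⟩
           (Q - μ * N) * ((fromℕ 1 + N) * j) + μ * N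
             ≈⟨ +-congʳ (trans (*-congˡ 1+N*j≈1) (*-identityʳ _)) ⟩
           Q - μ * N + μ * N
             ≈⟨ solve 2 (λ p Q → Q :- p :+ p := Q) refl (μ * N) Q ⟩
           Q ∎)))

    0<μ : 0# < μ
    0<μ = ≰⇒> λ μ≤0 → <⇒≱ (<-≤-trans 0<Q (quad≤μ x⁺))
      (≤-by (0≤* (≤0⇒0≤- μ≤0) (0≤x∙x x⁺))
        (solve 2 (λ μ N → μ :* N :+ :- μ :* N := con (+ 0)) refl μ (x⁺ ∙ x⁺)))

    psd : PositiveSemidefinite (shift μ M)
    psd x = ≤-trans (≤⇒0≤- (quad≤μ x)) (inj₂ (sym (quad-shift μ M x)))

    eigen : (∃[ x ] Nonzero x × quad (shift μ M) x ≈ 0#) ⊎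
            (∃[ L ] 0# < L × (∀ x → x ∙ x ≤ L * quad (shift μ M) x)) → IsEigenvalue ℝ M μ
    eigen (inj₁ (x , x≉0 , null)) = x , x≉0 , λ i → begin
      (M · x) i
        ≈⟨ solve 3 (λ μ x m → m := μ :* x :- (μ :* x :+ :- con (+ 1) :* m)) refl μ (x i) ((M · x) i) ⟩
      μ * x i - linComb μ x (- fromℕ 1) (M · x) i
        ≈⟨ +-congˡ (-‿cong (trans (sym (shift-· μ M x i)) (null⇒kernel (shift-sym μ M-sym) psd x null i))) ⟩
      μ * x i - 0#
        ≈⟨ solve 1 (λ p → p :- con (+ 0) := p) refl (μ * x i) ⟩
      μ * x i ∎
    -- Coercivity N ≤ L(μN - Q) rearranges to Q ≤ (μ - 1/L)N, so μ - 1/L would be a smaller upper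
    -- bound.
    eigen (inj₂ (L , 0<L , coercive)) with j , Lj≈1 , 0<j ← inverse⁺ 0<L =
      contradiction (μ-least (μ - j) (exceeded⇒≤ quad≤μ-j))
        (<⇒≱ (<-by 0<j (solve 2 (λ μ j → μ :- j :+ j := μ) refl μ j)))
      where
      quad≤μ-j : ∀ x → quad M x ≤ (μ - j) * (x ∙ x)
      quad≤μ-j x = ≤-by (0≤* (inj₁ 0<j) (≤⇒0≤- (≤-trans (coercive x) (inj₂ (*-congˡ (quad-shift μ M x)))))) (begin
        Q + j * (L * (μ * N - Q) - N)
          ≈⟨ solve 5 (λ Q j L μ N → Q :+ j :* (L :* (μ :* N :- Q) :- N)
                       := Q :+ L :* j :* (μ :* N :- Q) :- j :* N) refl Q j L μ N ⟩
        Q + L * j * (μ * N - Q) - j * N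
          ≈⟨ +-congʳ (+-congˡ (trans (*-congʳ Lj≈1) (*-identityˡ _))) ⟩
        Q + (μ * N - Q) - j * N
          ≈⟨ solve 4 (λ Q j μ N → Q :+ (μ :* N :- Q) :- j :* N := (μ :- j) :* N) refl Q j μ N ⟩
        (μ - j) * N ∎)
        where
        Q = quad M x
        N = x ∙ x

  -- Negation exchanges the two ends of the spectrum, and turns a negative semidefinite form into a
  -- positive semidefinite one.
  neg : Matrix ℝ n → Matrix ℝ n
  neg M i j = - M i j

  neg-· : ∀ (M : Matrix ℝ n) x i → (neg M · x) i ≈ - (M · x) i
  neg-· M x i = begin
    neg M i ∙ x
      ≈⟨ ∙-cong (λ j → solve 1 (λ m → :- m := con (+ 0) :* m :+ :- con (+ 1) :* m) refl (M i j)) (λ _ → refl) ⟩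
    linComb 0# (M i) (- fromℕ 1) (M i) ∙ x
      ≈⟨ ∙-linCombˡ 0# (M i) (- fromℕ 1) (M i) x ⟩
    0# * (M i ∙ x) + - fromℕ 1 * (M i ∙ x)
      ≈⟨ solve 1 (λ p → con (+ 0) :* p :+ :- con (+ 1) :* p := :- p) refl (M i ∙ x) ⟩
    - (M i ∙ x) ∎

  quad-neg : ∀ (M : Matrix ℝ n) x → quad (neg M) x ≈ - quad M x
  quad-neg M x = begin
    x ∙ (neg M · x)
      ≈⟨ ∙-congʳ x (λ i → trans (neg-· M x i)
           (solve 1 (λ m → :- m := con (+ 0) :* m :+ :- con (+ 1) :* m) refl ((M · x) i))) ⟩
    x ∙ linComb 0# (M · x) (- fromℕ 1) (M · x)
      ≈⟨ ∙-linCombʳ x 0# (M · x) (- fromℕ 1) (M · x) ⟩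
    0# * quad M x + - fromℕ 1 * quad M x
      ≈⟨ solve 1 (λ p → con (+ 0) :* p :+ :- con (+ 1) :* p := :- p) refl (quad M x) ⟩
    - quad M x ∎

  neg-eigenvalue : {M : Matrix ℝ n} → ∀ {μ} → IsEigenvalue ℝ (neg M) μ → IsEigenvalue ℝ M (- μ)
  neg-eigenvalue {M = M} {μ} (x , x≉0 , eq) = x , x≉0 , λ i → begin
    (M · x) i           ≈⟨ solve 1 (λ m → m := :- :- m) refl ((M · x) i) ⟩
    - - (M · x) i       ≈⟨ -‿cong (trans (sym (neg-· M x i)) (eq i)) ⟩
    - (μ * x i)         ≈⟨ solve 2 (λ μ x → :- (μ :* x) := :- μ :* x) refl μ (x i) ⟩
    - μ * x i           ∎

  -- If no eigenvalue is positive, then - M is positive semidefinite, and the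
  -- unit vectors are null vectors of it because the diagonal vanishes.
  eigenvalues≤0⇒zero : {M : Matrix ℝ n} → Symmetric M → (∀ i → M i i ≈ 0#) →
                       (∀ μ → IsEigenvalue ℝ M μ → μ ≤ 0#) → ∀ i j → M i j ≈ 0#
  eigenvalues≤0⇒zero {M = M} M-sym diagonal≈0 eigenvalues≤0 i j = begin
    M i j                       ≈⟨ ∙-unit (M i) j ⟨
    (M · unit j) i              ≈⟨ solve 1 (λ m → m := :- :- m) refl _ ⟩
    - - (M · unit j) i          ≈⟨ -‿cong (trans (sym (neg-· M (unit j) i)) kernel) ⟩
    - 0#                        ≈⟨ solve 0 (:- con (+ 0) := con (+ 0)) refl ⟩
    0#                          ∎
    where
    neg-psd : PositiveSemidefinite (neg M)
    neg-psd x = ≤-trans (≤0⇒0≤- (≮⇒≥ λ 0<Q → let μ , 0<μ , μ-eigen = positive-eigenvalue M-sym 0<Q in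
      <⇒≱ 0<μ (eigenvalues≤0 μ μ-eigen))) (inj₂ (sym (quad-neg M x)))

    kernel : (neg M · unit j) i ≈ 0#
    kernel = null⇒kernel (λ i j → -‿cong (M-sym i j)) neg-psd (unit j)
      (trans (quad-unit (neg M) j) (trans (-‿cong (diagonal≈0 j)) (solve 0 (:- con (+ 0) := con (+ 0)) refl))) i

  maxEigenvalue≉0 : {M : Matrix ℝ n} → Symmetric M → (∀ i → M i i ≈ 0#) → ∀ {i j} → M i j ≉ 0# →
                    ∀ {γ} → IsMaxEigenvalue ℝ M γ → γ ≉ 0#
  maxEigenvalue≉0 M-sym diagonal≈0 {i} {j} Mᵢⱼ≉0 (_ , maximal) γ≈0 = Mᵢⱼ≉0
    (eigenvalues≤0⇒zero M-sym diagonal≈0 (λ μ eig → ≤-trans (maximal μ eig) (inj₂ γ≈0)) i j)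

  -- An eigenvalue μ of `neg M` gives the eigenvalue - μ of `M`. If the least eigenvalue were zero,
  -- then μ ≤ 0 throughout, and `neg M` would vanish.
  minEigenvalue≉0 : {M : Matrix ℝ n} → Symmetric M → (∀ i → M i i ≈ 0#) → ∀ {i j} → M i j ≉ 0# →
                    ∀ {γ} → IsMinEigenvalue ℝ M γ → γ ≉ 0#
  minEigenvalue≉0 {M = M} M-sym diagonal≈0 {i} {j} Mᵢⱼ≉0 {γ} (_ , minimal) γ≈0 = Mᵢⱼ≉0 (begin
    M i j      ≈⟨ -‿involutive (M i j) ⟨
    - - M i j  ≈⟨ -‿cong (eigenvalues≤0⇒zero (λ i j → -‿cong (M-sym i j))
                    (λ i → trans (-‿cong (diagonal≈0 i)) -0#≈0#) eigenvalues≤0 i j) ⟩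
    - 0#       ≈⟨ -0#≈0# ⟩
    0#         ∎)
    where
    open RingProperties ring using (-‿involutive; -0#≈0#)
    eigenvalues≤0 : ∀ μ → IsEigenvalue ℝ (neg M) μ → μ ≤ 0#
    eigenvalues≤0 μ eig = ≤-by (≤-trans (inj₂ (sym γ≈0)) (minimal (- μ) (neg-eigenvalue eig))) (-‿inverseʳ μ)

-- Degrees and edge-degrees in a graph with one universal vertex.

open import Data.Nat.Base using (_≤_; _<_)

-- The hypothesis `1 < k` covers the default value 0 of the maximum.
suc-max-bound : ∀ {k xs} → 1 < k → All (λ x → suc x < k) xs → suc (max 0 xs) < k
suc-max-bound (s≤s 0<k) bounded = s≤s (max<v⁺ 0<k (All.map ℕ.s<s⁻¹ bounded))

module Degrees {n : ℕ} (Γ : Graph (suc n)) where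
  open Graph Γ

  ∈-neighbours⁺ : ∀ {i j} → i ~ j → j ∈ neighbours Γ i
  ∈-neighbours⁺ {i} {j} i~j = lookup⇒[]= j _ (≡.trans (lookup∘tabulate (does ∘ (i ~?_)) j) (dec-true (i ~? j) i~j))

  ∈-neighbours⁻ : ∀ {i j} → j ∈ neighbours Γ i → i ~ j
  ∈-neighbours⁻ {i} {j} j∈N = decidable-stable (i ~? j) λ i≁j →
    contradiction
      (≡.trans (≡.sym ([]=⇒lookup j∈N))
        (≡.trans (lookup∘tabulate (does ∘ (i ~?_)) j) (dec-false (i ~? j) i≁j)))
      λ ()

  neighbours⊆∁self : ∀ i → neighbours Γ i ⊆ ∁ ⁅ i ⁆
  neighbours⊆∁self i j∈N = x∉p⇒x∈∁p (x≢y⇒x∉⁅y⁆ λ j≡i → ~-irrefl (≡.sym j≡i) (∈-neighbours⁻ j∈N))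

  ∣∁self∣≡n : ∀ (i : Fin (suc n)) → ∣ ∁ ⁅ i ⁆ ∣ ≡ n
  ∣∁self∣≡n i = ≡.trans (∣∁p∣≡n∸∣p∣ ⁅ i ⁆) (≡.cong (suc n ℕ.∸_) (∣⁅x⁆∣≡1 i))

  degree≤n : ∀ i → degree Γ i ≤ n
  degree≤n i = ≡.subst (degree Γ i ≤_) (∣∁self∣≡n i) (p⊆q⇒∣p∣≤∣q∣ (neighbours⊆∁self i))

  universal⇒degree≡n : ∀ {u} → Universal Γ u → degree Γ u ≡ n
  universal⇒degree≡n {u} univ = ℕ.≤-antisym (degree≤n u)
    (≡.subst (_≤ degree Γ u) (∣∁self∣≡n u) (p⊆q⇒∣p∣≤∣q∣ λ {w} w∈∁u →
      ∈-neighbours⁺ (univ w (x∉⁅y⁆⇒x≢y (x∈∁p⇒x∉p w∈∁u)))))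

  maxDegree≡n : ∀ {u} → Universal Γ u → maxDegree Γ ≡ n
  maxDegree≡n {u} univ = max≈v⁺
    (≡.subst (List._∈ degrees Γ) (universal⇒degree≡n univ) (∈-map⁺ (degree Γ) (∈-allFin u)))
    (All.map⁺ (All.universal degree≤n (allFin (suc n)))) z≤n

  -- Adjacency is decidable and there are finitely many vertices, so a search turns the negated
  -- statement into a witness.
  nonuniversal⇒nonneighbour : ∀ {i} → ¬ Universal Γ i → ∃[ w ] w ≢ i × ¬ (i ~ w)
  nonuniversal⇒nonneighbour {i} ¬univ
    with w , ¬adj ← Fin.¬∀⟶∃¬ (suc n) (λ w → w ≢ i → i ~ w) (λ w → ¬? (w Fin.≟ i) →-dec (i ~? w)) ¬univ =
    w , (λ w≡i → ¬adj (contradiction w≡i)) , λ i~w → ¬adj λ _ → i~w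

  nonuniversal⇒degree<n : ∀ {i} → ¬ Universal Γ i → degree Γ i < n
  nonuniversal⇒degree<n {i} ¬univ with w , w≢i , i≁w ← nonuniversal⇒nonneighbour ¬univ =
    ≡.subst (degree Γ i <_) (∣∁self∣≡n i) (p⊂q⇒∣p∣<∣q∣
      (neighbours⊆∁self i , w , x∉p⇒x∈∁p (x≢y⇒x∉⁅y⁆ w≢i) , i≁w ∘ ∈-neighbours⁻))

  -- The inclusion of the common neighbours in the neighbours of `i` is proper: `j` is a neighbour
  -- of `i` but not of itself.
  edgeDegree<degreeˡ : ∀ {i j} → i ~ j → edgeDegree Γ i j < degree Γ i
  edgeDegree<degreeˡ {i} {j} i~j = p⊂q⇒∣p∣<∣q∣ (p∩q⊆p (neighbours Γ i) (neighbours Γ j) , j ,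
    ∈-neighbours⁺ i~j , λ j∈N∩N → ~-irrefl ≡.refl (∈-neighbours⁻ (p∩q⊆q (neighbours Γ i) (neighbours Γ j) j∈N∩N)))

  edgeDegree<degreeʳ : ∀ {i j} → i ~ j → edgeDegree Γ i j < degree Γ j
  edgeDegree<degreeʳ {i} {j} i~j =
    ≡.subst (_< degree Γ j) (≡.cong ∣_∣ (∩-comm (neighbours Γ j) (neighbours Γ i))) (edgeDegree<degreeˡ (~-sym i~j))

  -- A non-universal end has degree at most n - 1, and the edge-degree is smaller still, hence at
  -- most n - 2. If `i` is the universal vertex, the end `j` is not, since otherwise uniqueness
  -- would make the edge a loop.
  edgeDegree-bound : HasExactlyOneUniversalVertex Γ → ∀ {i j} → i ~ j → suc (edgeDegree Γ i j) < n
  edgeDegree-bound (u , _ , unique) {i} {j} i~j with u Fin.≟ i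
  ... | no u≢i = ℕ.≤-<-trans (edgeDegree<degreeˡ i~j) (nonuniversal⇒degree<n (u≢i ∘ unique))
  ... | yes ≡.refl = ℕ.≤-<-trans (edgeDegree<degreeʳ i~j)
          (nonuniversal⇒degree<n λ univ → ~-irrefl (unique univ) i~j)

  otherVertex : 0 < n → (u : Fin (suc n)) → ∃[ w ] w ≢ u
  otherVertex (s≤s _) zero    = suc zero , λ ()
  otherVertex (s≤s _) (suc _) = zero , λ ()

  nonadjacentPair : 0 < n → HasExactlyOneUniversalVertex Γ → ∃[ i ] ∃[ j ] j ≢ i × ¬ (i ~ j)
  nonadjacentPair 0<n (u , _ , unique) with i , i≢u ← otherVertex 0<n u =
    i , nonuniversal⇒nonneighbour (≢-sym i≢u ∘ unique)

  maxEdgeDegree-bound : 0 < n → HasExactlyOneUniversalVertex Γ → suc (maxEdgeDegree Γ) < n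
  maxEdgeDegree-bound 0<n one@(u , univ , _) with w , w≢u ← otherVertex 0<n u =
    -- The edge from `u` to `w` satisfies the bound too, which forces `1 < n`.
    suc-max-bound (ℕ.≤-<-trans (s≤s z≤n) (edgeDegree-bound one (univ w w≢u)))
      (All.map⁺ (All.map (edgeDegree-bound one)
        (All.all-filter (uncurry _~?_) (cartesianProduct (allFin (suc n)) (allFin (suc n))))))

-- Adjacency matrices and the comparison of the two bounds.

module _ (ℝ : CompleteOrderedField) where
  open CompleteOrderedField ℝ hiding (zero) renaming (_<_ to _<ᴿ_; _≤_ to _≤ᴿ_)
  open IntegerCoefficients ℝ
  open Solver using (solve; con; _:=_; _:+_; _:*_; _:-_; :-_)
  open Order ℝ
  open QuadraticForms ℝ using (Symmetric)
  open Eigenvalues ℝ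
  open RingProperties ring using (-‿involutive; -0#≈0#)
  open SetoidReasoning setoid

  module AdjacencyMatrix {v : ℕ} (G : Graph v) where
    open Graph G

    A : Matrix ℝ v
    A = adjacencyMatrix ℝ G

    adjacencyMatrix-sym : Symmetric A
    adjacencyMatrix-sym i j = reflexive (≡.cong (if_then 1# else 0#)
      (does-⇔ (mk⇔ ~-sym ~-sym) (i ~? j) (j ~? i)))

    adjacencyMatrix-diagonal : ∀ i → A i i ≈ 0#
    adjacencyMatrix-diagonal i = reflexive (≡.cong (if_then 1# else 0#)
      (dec-false (i ~? i) (~-irrefl ≡.refl)))

    adjacent⇒entry≉0 : ∀ {i j} → i ~ j → A i j ≉ 0#
    adjacent⇒entry≉0 {i} {j} i~j A≈0 = 0≉1 (trans (sym A≈0)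
      (reflexive (≡.cong (if_then 1# else 0#) (dec-true (i ~? j) i~j))))

    extremeEigenvalues≉0 : ∀ {i j} → i ~ j → ∀ {γ₁ γᵥ} →
      IsMaxEigenvalue ℝ A γ₁ → IsMinEigenvalue ℝ A γᵥ → γ₁ * γᵥ ≉ 0#
    extremeEigenvalues≉0 i~j γ₁-max γᵥ-min =
      [ maxEigenvalue≉0 adjacencyMatrix-sym adjacencyMatrix-diagonal (adjacent⇒entry≉0 i~j) γ₁-max
      , minEigenvalue≉0 adjacencyMatrix-sym adjacencyMatrix-diagonal (adjacent⇒entry≉0 i~j) γᵥ-min
      ] ∘ xy≈0⇒x≈0∨y≈0

  module _ {n : ℕ} (Γ : Graph (suc n)) (0<n : 0 < n) (one : HasExactlyOneUniversalVertex Γ) where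
    open Degrees Γ

    -- At s = v the polynomial CA(0, s, k, λ) is v(v - 1)(λ - v + 2).
    excludes-v : CAPExcludes ℝ Γ (suc n)
    excludes-v k ℓ _ (_ , ℓ≤λmax) = + 0 , <-by (*-pos (*-pos 0<s (fromℕ-mono-< 0<n)) 0<w)
      -- The variable `e` stands for `1#`, which differs from `con (+ 1)`; accordingly `two` is
      -- `fromℕ 2` unfolded, and `s` is `fromℕ (suc n)` unfolded.
      (solve 4 (λ m k ℓ e →
         let s = e :+ m ; x = con (+ 0) ; two = e :+ (e :+ con (+ 0)) in
         x :* (x :+ e) :* (s :- s) :- two :* x :* s :* (k :- s :+ e) :+ s :* (s :- e) :* (ℓ :- s :+ two)
           :+ s :* m :* (s :- (ℓ :+ two)) := con (+ 0))
         refl (fromℕ n) k ℓ 1#)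
      where
      s = fromℕ (suc n)
      0<s = 0<fromℕ-suc n
      0<w : 0# <ᴿ s - (ℓ + fromℕ 2)
      0<w = <⇒0<- (≤-<-trans (≤-by (≤⇒0≤- ℓ≤λmax)
              (solve 2 (λ ℓ λm → ℓ :+ con (+ 2) :+ (λm :- ℓ) := con (+ 2) :+ λm) refl ℓ (fromℕ (maxEdgeDegree Γ))))
            (≈-<-trans (sym (fromℕ-+ 2 (maxEdgeDegree Γ)))
              (fromℕ-mono-< (s≤s (maxEdgeDegree-bound 0<n one)))))

    -- The universal vertex gives Δ = v - 1, so the squared term is zero.
    haemersDenominator≈ : ∀ γ₁ γᵥ → haemersDenominator ℝ Γ γ₁ γᵥ ≈ - (γ₁ * γᵥ)
    haemersDenominator≈ γ₁ γᵥ = trans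
      (reflexive (≡.cong (λ Δ → (fromℕ (suc n) - fromℕ Δ - 1#) * (fromℕ (suc n) - fromℕ Δ - 1#) - γ₁ * γᵥ)
        (maxDegree≡n (proj₁ (proj₂ one)))))
      (solve 3 (λ m e p → (e :+ m :- m :- e) :* (e :+ m :- m :- e) :- p := :- p) refl (fromℕ n) 1# (γ₁ * γᵥ))

    -- A non-adjacent pair of `Γ` is an edge of the complement, so the adjacency matrix there has a
    -- nonzero entry and neither extreme eigenvalue is zero.
    haemersDenominator≉0 : ∀ {γ₁ γᵥ} →
      IsMaxEigenvalue ℝ (adjacencyMatrix ℝ (complement Γ)) γ₁ →
      IsMinEigenvalue ℝ (adjacencyMatrix ℝ (complement Γ)) γᵥ →
      haemersDenominator ℝ Γ γ₁ γᵥ ≉ 0#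
    haemersDenominator≉0 {γ₁} {γᵥ} γ₁-max γᵥ-min D≈0 =
      let i , j , j≢i , i≁j = nonadjacentPair 0<n one in
      AdjacencyMatrix.extremeEigenvalues≉0 (complement Γ) (≢-sym j≢i , i≁j) γ₁-max γᵥ-min (begin
        γ₁ * γᵥ                         ≈⟨ -‿involutive (γ₁ * γᵥ) ⟨
        - - (γ₁ * γᵥ)                   ≈⟨ -‿cong (haemersDenominator≈ γ₁ γᵥ) ⟨
        - haemersDenominator ℝ Γ γ₁ γᵥ  ≈⟨ -‿cong D≈0 ⟩
        - 0#                            ≈⟨ -0#≈0# ⟩
        0#                              ∎)

    haemersBound≈v : ∀ γ₁ γᵥ D≉0 → haemersBound ℝ Γ γ₁ γᵥ D≉0 ≈ fromℕ (suc n)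
    haemersBound≈v γ₁ γᵥ D≉0 = begin
      - (s * γ₁ * γᵥ) * D⁻¹
        ≈⟨ solve 4 (λ s p q d → :- (s :* p :* q) :* d := s :* (:- (p :* q) :* d)) refl s γ₁ γᵥ D⁻¹ ⟩
      s * (- (γ₁ * γᵥ) * D⁻¹)    ≈⟨ *-congˡ (*-congʳ (haemersDenominator≈ γ₁ γᵥ)) ⟨
      s * (D * D⁻¹)              ≈⟨ *-congˡ (proj₂ (inverse D D≉0)) ⟩
      s * 1#                     ≈⟨ *-identityʳ s ⟩
      s                          ∎
      where
      s = fromℕ (suc n)
      D = haemersDenominator ℝ Γ γ₁ γᵥ
      D⁻¹ = proj₁ (inverse D D≉0)

theorem5p9 : (ℝ : CompleteOrderedField) → let open CompleteOrderedField ℝ renaming (_<_ to _<ᴿ_) in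
    (v : ℕ) (Γ : Graph v) → 1 < v → HasExactlyOneUniversalVertex Γ →
    (b : ℕ) → IsGeneralisedCAPBound ℝ Γ b →
    (γ₁ γᵥ : Carrier) →
    IsMaxEigenvalue ℝ (adjacencyMatrix ℝ (complement Γ)) γ₁ →
    IsMinEigenvalue ℝ (adjacencyMatrix ℝ (complement Γ)) γᵥ →
    Σ[ D≉0 ∈ haemersDenominator ℝ Γ γ₁ γᵥ ≉ 0# ]
    fromℕ b <ᴿ haemersBound ℝ Γ γ₁ γᵥ D≉0
theorem5p9 ℝ (suc n) Γ (s≤s 0<n) one b (_ , b-least) γ₁ γᵥ γ₁-max γᵥ-min =
  -- The excluded clique size v is `suc n`, so leastness gives b ≤ n, which is strictly below the
  -- Haemers bound v = n + 1.
  D≉0 , <-≈-trans (fromℕ-mono-< (s≤s (b-least n (excludes-v ℝ Γ 0<n one))))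
                  (sym (haemersBound≈v ℝ Γ 0<n one γ₁ γᵥ D≉0))
  where
  open CompleteOrderedField ℝ using (sym)
  open Order ℝ using (<-≈-trans; fromℕ-mono-<)
  D≉0 = haemersDenominator≉0 ℝ Γ 0<n one γ₁-max γᵥ-min
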